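{- Let $T$ be a fixed tree. Then there exists a value $N = N(T)$ such that every graph $G$ with no subgraph isomorphic to $T$ satisfies $\mathrm{HG}(G) \leq N$.
   Context: All graphs are finite, simple and undirected. "Subgraph" means a not necessarily induced subgraph. For a vertex $v$ of a graph $G$, $N(v)$ denotes its set of neighbors, and $[q]=\{1,\dots,q\}$. Hat guessing game on $G$ with $q$ colors: a guessing strategy is a family of functions $\Gamma = \{\Gamma_v : v\in V(G)\}$ with $\Gamma_v : [q]^{N(v)} \to [q]$. A hat assignment is a (not necessarily proper) coloring $\varphi : V(G)\to[q]$. The player at $v$ guesses correctly if $\Gamma_v(\varphi|_{N(v)}) = \varphi(v)$. The strategy $\Gamma$ is winning for the players if for every hat assignment $\varphi$ at least one vertex $v$ guesses correctly. The hat guessing number $\mathrm{HG}(G)$ is the maximum integer $q$ such that the players have a winning guessing strategy on $G$ with $q$ colors. -}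

module Defs where

open import Level using (0ℓ)
open import Data.Fin.Base
  using (Fin; zero; suc; inject₁; fromℕ; inject≤; combine; remQuot)
open import Data.Fin.Properties
  using (any?; all?; ¬∀⟶∃¬; pigeonhole; inject≤-injective; remQuot-combine; <⇒≢)
  renaming (_≟_ to _≟ᶠ_)
open import Data.List.Base using (List; []; _∷_; length; filter; allFin)
open import Data.List.Membership.Propositional using (_∉_)
open import Data.List.Membership.Propositional.Properties using (∈-filter⁻)
open import Data.List.Relation.Unary.Any using (here; there)
open import Data.Nat.Base using (ℕ; zero; suc; NonZero; _+_; _*_; _⊔_; _≤_; _<_)
open import Data.Nat.Properties
  using (≤-trans; ≤-refl; m≤m⊔n; m≤n⊔m; _≤?_; ≰⇒>; ≤-pred; ≤∧≢⇒<; n≤1+n)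
open import Data.Product.Base using (∃; _×_; _,_; proj₁; proj₂)
open import Data.Vec.Base as Vec using (Vec; []; _∷_; fromList)
open import Data.Vec.Functional as Fun using ()
open import Function.Base using (_∘_)
open import Function.Definitions using (Injective)
open import Relation.Binary.Core using (Rel)
open import Relation.Binary.Construct.Closure.ReflexiveTransitive using (Star)
open import Relation.Binary.Definitions using (Symmetric; Irreflexive; Decidable)
open import Relation.Binary.PropositionalEquality
  using (_≡_; _≢_; refl; sym; trans; cong; cong₂; subst)
open import Relation.Nullary using (¬_; Dec; yes; no; contradiction)
open import Relation.Nullary.Decidable using (map′; ¬?; decidable-stable)
open import Relation.Unary using () renaming (Decidable to Decidable₁)

------------------------------------------------------------------------
-- Graphs

record Graph : Set₁ where
  field
    order : ℕ

  Vertex : Set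
  Vertex = Fin order

  field
    Adj        : Rel Vertex 0ℓ
    adj?       : Decidable Adj
    adj-sym    : Symmetric Adj
    adj-irrefl : Irreflexive _≡_ Adj

  neighbours : Vertex → List Vertex
  neighbours v = filter (adj? v) (allFin order)

  degree : Vertex → ℕ
  degree v = length (neighbours v)

open Graph

-- H ⊑ G: some (not necessarily induced) subgraph of G is isomorphic to H.
-- Such a subgraph is the image of an injective, adjacency-preserving map.
record _⊑_ (H G : Graph) : Set where
  field
    embed     : Vertex H → Vertex G
    injective : Injective _≡_ _≡_ embed
    preserves : ∀ {u v} → Adj H u v → Adj G (embed u) (embed v)

-- A cycle on 3 + k distinct vertices.
record Cycle (G : Graph) : Set where
  field
    k         : ℕ
    vertex    : Fin (3 + k) → Vertex G
    injective : Injective _≡_ _≡_ vertex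
    step      : ∀ i → Adj G (vertex (inject₁ i)) (vertex (suc i))
    close     : Adj G (vertex (fromℕ (2 + k))) (vertex zero)

record IsTree (T : Graph) : Set where
  field
    nonEmpty  : NonZero (order T)
    connected : ∀ u v → Star (Adj T) u v
    acyclic   : ¬ Cycle T

------------------------------------------------------------------------
-- The hat guessing game

Assignment : Graph → ℕ → Set
Assignment G q = Vertex G → Fin q

-- [q]^N(v) is represented by vectors indexed by the (duplicate-free) list of
-- neighbours of v.  With the function type (u : Vertex G) → Adj G v u → Fin q
-- a strategy could not be assumed to respect pointwise equality.
View : (G : Graph) → ℕ → Vertex G → Set
View G q v = Vec (Fin q) (degree G v)

restrict : (G : Graph) {q : ℕ} → Assignment G q → (v : Vertex G) → View G q v
restrict G φ v = Vec.map φ (fromList (neighbours G v))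

Strategy : Graph → ℕ → Set
Strategy G q = (v : Vertex G) → View G q v → Fin q

IsWinning : (G : Graph) {q : ℕ} → Strategy G q → Set
IsWinning G Γ = ∀ φ → ∃ λ v → Γ v (restrict G φ v) ≡ φ v

Winning : Graph → ℕ → Set
Winning G q = ∃ λ (Γ : Strategy G q) → IsWinning G Γ

------------------------------------------------------------------------
-- Decidability of Winning, by exhaustive search

private
  variable
    n q s : ℕ
    A : Set

  -- Existential quantification over A is decidable for decidable predicates
  -- that respect _≈_.
  Searchable : (A : Set) → Rel A 0ℓ → Set₁
  Searchable A _≈_ = (P : A → Set) → (∀ {x y} → x ≈ y → P x → P y) →
                     Decidable₁ P → Dec (∃ P)

  Pointwise : {I : Set} {B : I → Set} → (∀ i → Rel (B i) 0ℓ) → Rel (∀ i → B i) 0ℓ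
  Pointwise R f g = ∀ i → R i (f i) (g i)

  search-Fin : Searchable (Fin q) _≡_
  search-Fin P resp P? = any? P?

  cons : {B : Fin (suc n) → Set} → B zero → (∀ i → B (suc i)) → ∀ i → B i
  cons b f zero    = b
  cons b f (suc i) = f i

  search-Π : {B : Fin n → Set} (R : ∀ i → Rel (B i) 0ℓ) → (∀ i b → R i b b) →
             (∀ i → Searchable (B i) (R i)) → Searchable (∀ i → B i) (Pointwise R)
  search-Π {zero} {B} R rfl srch P resp P? =
    map′ (nil ,_) (λ (f , p) → resp {f} {nil} (λ ()) p) (P? nil)
    where
    nil : ∀ i → B i
    nil ()
  search-Π {suc n} {B} R rfl srch P resp P? =
    map′ (λ (b , f , p) → cons b f , p)
         (λ (f , p) → f zero , f ∘ suc , resp {f} (η f) p)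
         (srch zero (λ b → ∃ λ f → P (cons b f))
           (λ r (f , p) → f , resp (λ { zero → r ; (suc i) → rfl (suc i) (f i) }) p)
           λ b → search-Π (R ∘ suc) (rfl ∘ suc) (srch ∘ suc) (P ∘ cons b)
             (λ r → resp λ { zero → rfl zero b ; (suc i) → r i }) (P? ∘ cons b))
    where
    η : ∀ f → Pointwise R f (cons (f zero) (f ∘ suc))
    η f zero    = rfl zero (f zero)
    η f (suc i) = rfl (suc i) (f (suc i))

  search-Vec : ∀ k → Searchable (Vec (Fin q) k → Fin q) (Pointwise λ _ → _≡_)
  search-Vec zero P resp P? =
    map′ (λ (c , p) → (λ _ → c) , p)
         (λ (f , p) → f [] , resp {f} {λ _ → f []} (λ { [] → refl }) p)
         (any? (λ c → P? (λ _ → c)))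
  search-Vec {q} (suc k) P resp P? =
    map′ (λ (f , p) → uncons f , p)
         (λ (f , p) → (λ c cs → f (c ∷ cs)) , resp {f} (λ { (c ∷ cs) → refl }) p)
         (search-Π (λ _ → Pointwise λ _ → _≡_) (λ _ _ _ → refl) (λ _ → search-Vec k)
           (P ∘ uncons) (λ r → resp λ { (c ∷ cs) → r c cs }) (P? ∘ uncons))
    where
    uncons : (Fin q → Vec (Fin q) k → Fin q) → Vec (Fin q) (suc k) → Fin q
    uncons f (c ∷ cs) = f c cs

  map-cong : {f g : A → Fin q} → (∀ x → f x ≡ g x) →
             ∀ {k} (xs : Vec A k) → Vec.map f xs ≡ Vec.map g xs
  map-cong e []       = refl
  map-cong e (x ∷ xs) = cong₂ _∷_ (e x) (map-cong e xs)

isWinning? : (G : Graph) (Γ : Strategy G q) → Dec (IsWinning G Γ)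
isWinning? G Γ =
  map′ (λ ¬∃ φ → decidable-stable (correct? φ) (λ ¬p → ¬∃ (φ , ¬p)))
       (λ w (φ , ¬p) → ¬p (w φ))
       (¬? (search-Π (λ _ → _≡_) (λ _ _ → refl) (λ _ → search-Fin)
         (λ φ → ¬ Correct φ)
         (λ {φ} {ψ} e ¬p (v , p) → ¬p (v , trans
           (cong (Γ v) (map-cong e (fromList (neighbours G v))))
           (trans p (sym (e v)))))
         (λ φ → ¬? (correct? φ))))
  where
  Correct : Assignment G _ → Set
  Correct φ = ∃ λ v → Γ v (restrict G φ v) ≡ φ v
  correct? : ∀ φ → Dec (Correct φ)
  correct? φ = any? λ v → Γ v (restrict G φ v) ≟ᶠ φ v

winning? : (G : Graph) → Decidable₁ (Winning G)
winning? G q =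
  search-Π (λ _ → Pointwise λ _ → _≡_) (λ _ _ _ → refl) (λ v → search-Vec (degree G v))
    (IsWinning G)
    (λ {Γ} {Δ} e w φ → let (v , p) = w φ in
      v , trans (sym (e v (restrict G φ v))) p)
    (isWinning? G)

------------------------------------------------------------------------
-- A bound on the number of colours with which the players can win

-- If each of n players makes s guesses, bound n s colours suffice to defeat
-- them: offer player 0 any of s + 1 colours, treat the guesses of the others
-- over all these colours as (s + 1) s guesses in the game on n - 1 players,
-- and then pick a colour that player 0 does not guess.
bound : ℕ → ℕ → ℕ
bound zero    s = 0
bound (suc n) s = suc s ⊔ bound n (suc s * s)

private
  avoid : bound n s ≤ q → (g : Fin n → (Fin n → Fin q) → Fin s → Fin q) →
          (∀ v {φ ψ} → (∀ u → u ≢ v → φ u ≡ ψ u) → ∀ i → g v φ i ≡ g v ψ i) →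
          ∃ λ φ → ∀ v i → g v φ i ≢ φ v
  avoid {zero} _ g loc = (λ ()) , λ ()
  avoid {suc n} {s} {q} b≤q g loc =
    (ι c Fun.∷ ψ) , λ { zero i eq → c∉ (i , trans (loc zero off₀ i) eq)
                      ; (suc v) i eq → ψ-avoids v (combine c i) (trans (unfold v i) eq) }
    where
    s<q : suc s ≤ q
    s<q = ≤-trans (m≤m⊔n (suc s) (bound n (suc s * s))) b≤q

    ι : Fin (suc s) → Fin q
    ι i = inject≤ i s<q

    g′ : Fin n → (Fin n → Fin q) → Fin (suc s * s) → Fin q
    g′ v ψ k = let (c , i) = remQuot {suc s} s k in g (suc v) (ι c Fun.∷ ψ) i

    ih : ∃ λ ψ → ∀ v i → g′ v ψ i ≢ ψ v
    ih = avoid (≤-trans (m≤n⊔m (suc s) (bound n (suc s * s))) b≤q) g′ λ v e k →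
      loc (suc v) (λ { zero _ → refl ; (suc u) u≢v → e u (u≢v ∘ cong suc) }) _

    ψ = proj₁ ih
    ψ-avoids = proj₂ ih

    guesses : Fin s → Fin q
    guesses = g zero (ι zero Fun.∷ ψ)

    fresh : ∃ λ c → ¬ ∃ λ i → guesses i ≡ ι c
    fresh = ¬∀⟶∃¬ (suc s) _ (λ c → any? λ i → guesses i ≟ᶠ ι c) λ all →
      let (c , d , c<d , e) = pigeonhole ≤-refl (proj₁ ∘ all) in
      <⇒≢ c<d (inject≤-injective s<q s<q c d
        (trans (sym (proj₂ (all c)))
          (trans (cong guesses e) (proj₂ (all d)))))

    c = proj₁ fresh
    c∉ = proj₂ fresh

    off₀ : ∀ u → u ≢ zero → (ι zero Fun.∷ ψ) u ≡ (ι c Fun.∷ ψ) u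
    off₀ zero    u≢0 = contradiction refl u≢0
    off₀ (suc u) _   = refl

    unfold : ∀ v i → g′ v ψ (combine c i) ≡ g (suc v) (ι c Fun.∷ ψ) i
    unfold v i = cong (λ (d , j) → g (suc v) (ι d Fun.∷ ψ) j) (remQuot-combine c i)

  map-local : ∀ {φ ψ : Fin n → Fin q} v (us : List (Fin n)) → v ∉ us →
              (∀ u → u ≢ v → φ u ≡ ψ u) →
              Vec.map φ (fromList us) ≡ Vec.map ψ (fromList us)
  map-local v []       v∉ e = refl
  map-local v (u ∷ us) v∉ e =
    cong₂ _∷_ (e u λ { refl → v∉ (here refl) }) (map-local v us (v∉ ∘ there) e)

winning⇒<bound : (G : Graph) → Winning G q → q < bound (order G) 1
winning⇒<bound {q} G (Γ , w) with bound (order G) 1 ≤? q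
... | no  b≰q = ≰⇒> b≰q
... | yes b≤q = contradiction (proj₂ (w φ)) (avoids _ zero)
  where
  lost : ∃ λ φ → ∀ v (i : Fin 1) → Γ v (restrict G φ v) ≢ φ v
  lost = avoid b≤q (λ v φ _ → Γ v (restrict G φ v)) λ v e _ →
    cong (Γ v) (map-local v (neighbours G v)
      (λ v∈ → adj-irrefl G refl (proj₂ (∈-filter⁻ (adj? G v) {xs = allFin (order G)} v∈))) e)
  φ = proj₁ lost
  avoids = proj₂ lost

------------------------------------------------------------------------
-- The hat guessing number

-- The largest m ≤ b with P m; 0 if there is none.
greatest : {P : ℕ → Set} → Decidable₁ P → ℕ → ℕ
greatest P? zero    = zero
greatest P? (suc b) with P? (suc b)
... | yes _ = suc b
... | no  _ = greatest P? b

private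
  greatest-upper : {P : ℕ → Set} (P? : Decidable₁ P) → ∀ {m} b → m ≤ b → P m →
                   m ≤ greatest P? b
  greatest-upper P? zero m≤b p = m≤b
  greatest-upper P? {m} (suc b) m≤b p with P? (suc b)
  ... | yes _ = m≤b
  ... | no ¬p = greatest-upper P? b (≤-pred (≤∧≢⇒< m≤b λ { refl → ¬p p })) p

  greatest-holds : {P : ℕ → Set} (P? : Decidable₁ P) → ∀ b →
                   greatest P? b ≢ 0 → P (greatest P? b)
  greatest-holds P? zero ≢0 = contradiction refl ≢0
  greatest-holds P? (suc b) ≢0 with P? (suc b)
  ... | yes p = p
  ... | no  _ = greatest-holds P? b ≢0

-- The maximum q such that the players win with q colours; see HG-isMaximum.
-- On the graph without vertices they never win, and HG is 0 there.
HG : Graph → ℕ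
HG G = greatest (winning? G) (bound (order G) 1)

HG-upper : (G : Graph) → Winning G q → q ≤ HG G
HG-upper G w = greatest-upper (winning? G) _
  (≤-trans (n≤1+n _) (winning⇒<bound G w)) w

HG-winning : (G : Graph) → HG G ≢ 0 → Winning G (HG G)
HG-winning G = greatest-holds (winning? G) (bound (order G) 1)

HG-isMaximum : (G : Graph) → .{{NonZero (order G)}} →
               Winning G (HG G) × (∀ {q} → Winning G q → q ≤ HG G)
HG-isMaximum G = HG-winning G (λ eq → 1≢0 (subst (1 ≤_) eq (HG-upper G win₁))) , HG-upper G
  where
  1≢0 : ¬ (1 ≤ 0)
  1≢0 ()
  vertex : ∀ {n} → .{{NonZero n}} → Fin n
  vertex {suc _} = zero
  unique : (i j : Fin 1) → i ≡ j
  unique zero zero = refl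
  win₁ : Winning G 1
  win₁ = (λ _ _ → zero) , λ φ → vertex , unique _ _

{-# OPTIONS --safe #-}
module Submission where

-- Let the players make s guesses each, and restrict the hats to a list of
-- ℓ + 1 colours. If the vertices split into A and B such that every vertex of A
-- has at most d neighbours in B, and the players on G[B] lose with lists of size
-- m, then the colours on B may be treated as unknown to A at the price of
-- m ^ d s guesses instead of s; once A is coloured, B is an ordinary game. Peeling
-- off the classes of a proper colouring bounds the game for bounded degree.
--
-- Let T be obtained from T′ by attaching a leaf, and let G be T-free. The set H of
-- vertices of degree at least |T′| + 1 induces a T′-free graph, because a copy of
-- T′ in H could be extended greedily by the leaf. The other vertices have bounded
-- degree, so the splitting (G - H, H) reduces T to T′.

open import Defs
open import Data.Nat.Base using (_≤_)
open import Data.Product.Base using (∃-syntax)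
open import Relation.Nullary using (¬_)

open import Data.Bool.Base using (if_then_else_)
open import Data.Fin.Base
  using (Fin; zero; suc; toℕ; inject₁; fromℕ; inject≤; combine; remQuot)
open import Data.Fin.Properties
  using (_≟_; any?; ¬∀⟶∃¬; pigeonhole; inject≤-injective; remQuot-combine; <⇒≢;
         toℕ<n; toℕ-injective)
open import Data.List.Base using (List; []; _∷_; [_]; _∷ʳ_; length; filter; allFin; lookup)
open import Data.List.Membership.Propositional using (_∈_; _∉_)
open import Data.List.Membership.Propositional.Properties
  using (∈-filter⁺; ∈-filter⁻; ∈-allFin; ∈-lookup; ∈-++⁻)
import Data.List.Membership.DecPropositional as DecMembership
open import Data.List.Relation.Binary.Subset.Propositional using (_⊆_)
import Data.List.Relation.Unary.All as All
open import Data.List.Relation.Unary.All.Properties using (¬Any⇒All¬)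
open import Data.List.Relation.Unary.AllPairs using ([]; _∷_)
open import Data.List.Relation.Unary.Any using (here; there; index)
open import Data.List.Relation.Unary.Any.Properties using (lookup-index)
open import Data.List.Relation.Unary.Unique.Propositional using (Unique)
open import Data.List.Relation.Unary.Unique.Propositional.Properties
  using (++⁺; allFin⁺; filter⁺)
open import Data.Nat.Base using (ℕ; zero; suc; _*_; _^_; _⊔_; _<_; s≤s; NonZero)
open import Data.Nat.Properties
  using (≤-refl; _≤?_; ≰⇒>; m≤m⊔n; m≤n⊔m; m<1+n⇒m<n∨m≡n; m≤n⇒m≤1+n; _<?_; n≮0)
open import Data.Product.Base using (∃; _×_; _,_; proj₁; proj₂)
open import Data.Sum.Base using (_⊎_; inj₁; inj₂)
open import Data.Unit.Base using (⊤; tt)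
open import Data.Vec.Base as Vec using (_∷_; fromList)
open import Data.Vec.Functional using (updateAt)
open import Data.Vec.Functional.Properties using (updateAt-updates; updateAt-minimal)
open import Function.Base using (_∘_; const; id)
open import Function.Definitions using (Injective)
open import Level using (0ℓ)
open import Relation.Binary.Construct.Closure.ReflexiveTransitive using (Star; ε; _◅_)
open import Relation.Binary.Definitions using (DecidableEquality)
open import Relation.Binary.PropositionalEquality
  using (_≡_; _≢_; refl; sym; trans; cong; cong₂; subst; subst₂)
open import Relation.Nullary using (Dec; does; yes; no; contradiction)
open import Relation.Nullary.Decidable using (_×-dec_)
open import Relation.Unary using (Pred; Decidable)

open Graph

-- Fresh values and codes for partial colourings

fresh : ∀ {A : Set} {m n} → DecidableEquality A → m < n →
        (f : Fin m → A) {e : Fin n → A} → Injective _≡_ _≡_ e →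
        ∃ λ i → ∀ j → f j ≢ e i
fresh _≟ₐ_ m<n f {e} e-inj =
  let (i , ∄) = ¬∀⟶∃¬ _ _ (λ i → any? λ j → f j ≟ₐ e i) λ hit →
        let (i , i′ , i<i′ , eq) = pigeonhole m<n (proj₁ ∘ hit)
        in <⇒≢ i<i′ (e-inj (trans (sym (proj₂ (hit i)))
                             (trans (cong f eq) (proj₂ (hit i′)))))
  in i , λ j eq → ∄ (j , eq)

lookup-injective : ∀ {A : Set} {xs : List A} → Unique xs → Injective _≡_ _≡_ (lookup xs)
lookup-injective (_ ∷ _) {zero} {zero} _ = refl
lookup-injective {xs = _ ∷ xs} (x≢ ∷ _) {zero} {suc j} eq =
  contradiction eq (All.lookup x≢ (∈-lookup {xs = xs} j))
lookup-injective {xs = _ ∷ xs} (x≢ ∷ _) {suc i} {zero} eq =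
  contradiction (sym eq) (All.lookup x≢ (∈-lookup {xs = xs} i))
lookup-injective (_ ∷ u) {suc i} {suc j} eq = cong suc (lookup-injective u eq)

module _ {n ℓ : ℕ} where

  -- decode d us k is the k-th colouring of the first d entries of us; the other
  -- vertices get the junk colour zero.
  decode : ∀ d → List (Fin n) → Fin (suc ℓ ^ d) → Fin n → Fin (suc ℓ)
  decode zero    us       k u = zero
  decode (suc d) []       k u = zero
  decode (suc d) (x ∷ us) k u =
    let (c , k′) = remQuot (suc ℓ ^ d) k in
    if does (u ≟ x) then c else decode d us k′ u

  -- Digits in base `suc ℓ`; those past the end of a short list are zero, so that all lists share
  -- one index set.
  encode : ∀ d → List (Fin n) → (Fin n → Fin (suc ℓ)) → Fin (suc ℓ ^ d)
  encode zero    us       ψ = zero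
  encode (suc d) []       ψ = combine {suc ℓ} zero (encode d [] ψ)
  encode (suc d) (x ∷ us) ψ = combine (ψ x) (encode d us ψ)

  decode-encode : ∀ d {us} → length us ≤ d → ∀ ψ {u} → u ∈ us →
                  decode d us (encode d us ψ) u ≡ ψ u
  decode-encode (suc d) {x ∷ us} (s≤s us≤d) ψ {u} u∈ =
    trans (cong (λ (c , k) → if does (u ≟ x) then c else decode d us k u)
            (remQuot-combine (ψ x) (encode d us ψ)))
          (branch u∈)
    where
    branch : u ∈ x ∷ us →
             (if does (u ≟ x) then ψ x else decode d us (encode d us ψ) u) ≡ ψ u
    branch u∈ with u ≟ x | u∈
    ... | yes refl | _         = refl
    ... | no  u≢x  | here u≡x  = contradiction u≡x u≢x
    ... | no  _    | there u∈′ = decode-encode d us≤d ψ u∈′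

-- Losing games on vertex sets

-- A number of colours, less one, that defeats `c` classes: the last one, independent, makes
-- `suc ℓ ^ d * s` guesses; the others need only `ℓ`.
partiteBound : ℕ → ℕ → ℕ → ℕ
partiteBound d zero    s = s
partiteBound d (suc c) s = let ℓ = partiteBound d c s in (suc ℓ ^ d * s) ⊔ ℓ

module Game (G : Graph) where

  private
    V = Vertex G
    _~_ = Adj G

  -- Strategies and colourings stay total on all vertices; this condition hides the colours outside
  -- `U` from the players in `U`, so that no induced subgraph has to be formed.
  Local : ∀ {k s q} → Pred V 0ℓ → (V → (V → Fin k) → Fin s → Fin q) → Set
  Local U g = ∀ {v} → U v → ∀ {φ ψ} → (∀ {u} → U u → v ~ u → φ u ≡ ψ u) →
              ∀ i → g v φ i ≡ g v ψ i

  -- The players on G[U] lose although each of them makes s guesses and the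
  -- hats are restricted to suc ℓ colours, namely the image of ι.
  Losing : ℕ → ℕ → Pred V 0ℓ → Set
  Losing s ℓ U = ∀ {q} {ι : Fin (suc ℓ) → Fin q} → Injective _≡_ _≡_ ι →
                 (g : V → (V → Fin (suc ℓ)) → Fin s → Fin q) → Local U g →
                 ∃ λ φ → ∀ {v} → U v → ∀ i → g v φ i ≢ ι (φ v)

  -- `Losing` covers every list `ι`, so the game can be played on the first `suc ℓ` colours of a
  -- longer list.
  losing-mono : ∀ {s ℓ ℓ′ U} → ℓ ≤ ℓ′ → Losing s ℓ U → Losing s ℓ′ U
  losing-mono {ℓ = ℓ} {ℓ′} ℓ≤ℓ′ lose {ι = ι} ι-inj g loc =
    let (φ , wrong) = lose {ι = ι ∘ κ} (inject≤-injective (s≤s ℓ≤ℓ′) (s≤s ℓ≤ℓ′) _ _ ∘ ι-inj)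
                        (λ v φ → g v (κ ∘ φ)) (λ Uv e → loc Uv (λ Uu v~u → cong κ (e Uu v~u)))
    in κ ∘ φ , wrong
    where
    κ : Fin (suc ℓ) → Fin (suc ℓ′)
    κ i = inject≤ i (s≤s ℓ≤ℓ′)

  losing-resp : ∀ {s ℓ} {U U′ : Pred V 0ℓ} → (∀ {v} → U v → U′ v) → (∀ {v} → U′ v → U v) →
                Losing s ℓ U → Losing s ℓ U′
  losing-resp U⊆U′ U′⊆U lose ι-inj g loc =
    let (φ , wrong) = lose ι-inj g (λ Uv e → loc (U⊆U′ Uv) (λ U′u → e (U′⊆U U′u)))
    in φ , wrong ∘ U′⊆U

  -- No player in `U` sees another, so the guesses are constant and each vertex separately picks one
  -- of `suc s` colours outside its `s` guesses.
  independent-losing : ∀ {s U} → (∀ {u v} → U u → U v → ¬ u ~ v) → Losing s s U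
  independent-losing ind ι-inj g loc =
    proj₁ ∘ choice , λ {v} Uv i eq →
      proj₂ (choice v) i (trans (loc Uv (λ Uu v~u → contradiction v~u (ind Uv Uu)) i) eq)
    where
    choice = λ v → fresh _≟_ ≤-refl (g v (const zero)) ι-inj

  -- A is played first. Its players do not know the colours on B, so they make
  -- their guesses for all suc ℓ ^ d colourings of their neighbourhoods in B.
  union-losing : ∀ {s a ℓ d} {U A B : Pred V 0ℓ} → Decidable B →
                 (∀ {v} → A v → U v) → (∀ {v} → B v → U v) → (∀ {v} → U v → A v ⊎ B v) →
                 (us : V → List V) → (∀ {v} → A v → length (us v) ≤ d) →
                 (∀ {v u} → A v → B u → v ~ u → u ∈ us v) →
                 Losing (suc ℓ ^ d * s) a A → Losing s ℓ B → Losing s (a ⊔ ℓ) U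
  union-losing {s} {a} {ℓ} {d} {U} {A} {B} B? A⊆U B⊆U U⊆A∪B us us≤d ∈us loseA loseB
               {q} {ι} ι-inj g loc = mix φ ψ , wrong
    where
    m = suc (a ⊔ ℓ)

    -- `B` keeps to the first `suc ℓ` of the `m` colours, so the number `suc ℓ ^ d` of colourings to
    -- be guessed against does not grow with `a`.
    κ : Fin (suc ℓ) → Fin m
    κ i = inject≤ i (s≤s (m≤n⊔m a ℓ))

    κ-inj : Injective _≡_ _≡_ κ
    κ-inj = inject≤-injective (s≤s (m≤n⊔m a ℓ)) (s≤s (m≤n⊔m a ℓ)) _ _

    mix : (V → Fin m) → (V → Fin (suc ℓ)) → V → Fin m
    mix φ ψ v = if does (B? v) then κ (ψ v) else φ v

    mix-congˡ : ∀ {φ φ′} ψ {u} → U u → (A u → φ u ≡ φ′ u) → mix φ ψ u ≡ mix φ′ ψ u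
    mix-congˡ ψ {u} Uu e with B? u | U⊆A∪B Uu
    ... | yes _  | _       = refl
    ... | no  _  | inj₁ Au = e Au
    ... | no ¬Bu | inj₂ Bu = contradiction Bu ¬Bu

    mix-congʳ : ∀ φ {ψ ψ′ u} → (B u → ψ u ≡ ψ′ u) → mix φ ψ u ≡ mix φ ψ′ u
    mix-congʳ φ {u = u} e with B? u
    ... | yes Bu = cong κ (e Bu)
    ... | no  _  = refl

    gA : V → (V → Fin m) → Fin (suc ℓ ^ d * s) → Fin q
    gA v φ k = let (p , i) = remQuot s k in g v (mix φ (decode d (us v) p)) i

    gA-local : Local A gA
    gA-local {v} Av {φ} {φ′} e k = let (p , i) = remQuot {suc ℓ ^ d} s k in
      loc (A⊆U Av)
        (λ Uu v~u → mix-congˡ {φ} {φ′} (decode d (us v) p) Uu (λ Au → e Au v~u)) i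

    φ-lost : ∃ λ φ → ∀ {v} → A v → ∀ k → gA v φ k ≢ ι (φ v)
    φ-lost = losing-mono (m≤m⊔n a ℓ) loseA ι-inj gA gA-local
    φ = proj₁ φ-lost

    ψ-lost : ∃ λ ψ → ∀ {v} → B v → ∀ i → g v (mix φ ψ) i ≢ ι (κ (ψ v))
    ψ-lost = loseB (κ-inj ∘ ι-inj) (λ v ψ → g v (mix φ ψ)) λ Bv {ψ} {ψ′} e →
      loc (B⊆U Bv) (λ {u} _ v~u → mix-congʳ φ {ψ} {ψ′} (λ Bu → e Bu v~u))
    ψ = proj₁ ψ-lost

    -- The code of the actual `ψ` is among those already ruled out for `v`; junk colours from
    -- `decode` go unseen, as all neighbours of `v` in `B` lie in `us v`.
    gA-combine : ∀ {v} → A v → ∀ i →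
                 gA v φ (combine (encode d (us v) ψ) i) ≡ g v (mix φ ψ) i
    gA-combine {v} Av i =
      trans (cong (λ (p , j) → g v (mix φ (decode d (us v) p)) j)
              (remQuot-combine (encode d (us v) ψ) i))
            (loc (A⊆U Av) (λ _ v~u →
              mix-congʳ φ {decode d (us v) (encode d (us v) ψ)} {ψ} λ Bu →
                decode-encode d (us≤d Av) ψ (∈us Av Bu v~u)) i)

    wrong : ∀ {v} → U v → ∀ i → g v (mix φ ψ) i ≢ ι (mix φ ψ v)
    wrong {v} Uv i eq with B? v | U⊆A∪B Uv
    ... | yes Bv | _       = proj₂ ψ-lost Bv i eq
    ... | no  _  | inj₁ Av = proj₂ φ-lost Av _ (trans (gA-combine Av i) eq)
    ... | no ¬Bv | inj₂ Bv = contradiction Bv ¬Bv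

  -- Vertex sets of bounded degree

  module _ {d : ℕ} {U : Pred V 0ℓ} (U? : Decidable U)
           (us : V → List V) (us≤d : ∀ {v} → U v → length (us v) ≤ d)
           (∈us : ∀ {v u} → U v → U u → v ~ u → u ∈ us v) where

    -- Greedy: at most `d` listed neighbours leave one of `suc d` colours free for `w`. If `w`
    -- recurs in `vs`, it is merely recoloured.
    colouring : ∀ vs → ∃ λ (col : V → Fin (suc d)) →
                ∀ {u v} → u ∈ vs → v ∈ vs → U u → U v → u ~ v → col u ≢ col v
    colouring []       = const zero , λ ()
    colouring (w ∷ vs) with colouring vs | U? w
    ... | col , proper | no ¬Uw = col , λ where
      (here refl) _           Uu _  → contradiction Uu ¬Uw
      _           (here refl) _  Uv → contradiction Uv ¬Uw
      (there u∈)  (there v∈)        → proper u∈ v∈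
    ... | col , proper | yes Uw = col′ , proper′
      where
      new = fresh _≟_ (s≤s (us≤d Uw)) (col ∘ lookup (us w)) id
      c = proj₁ new

      col′ : V → Fin (suc d)
      col′ = updateAt col w (const c)

      unused : ∀ {u} → w ~ u → U u → col u ≢ c
      unused w~u Uu eq = let u∈ = ∈us Uw Uu w~u in
        proj₂ new (index u∈) (trans (cong col (sym (lookup-index u∈))) eq)

      ∈-tail : ∀ {u} → u ≢ w → u ∈ w ∷ vs → u ∈ vs
      ∈-tail u≢w (here u≡w)  = contradiction u≡w u≢w
      ∈-tail u≢w (there u∈)  = u∈

      proper′ : ∀ {u v} → u ∈ w ∷ vs → v ∈ w ∷ vs → U u → U v → u ~ v → col′ u ≢ col′ v
      proper′ {u} {v} u∈ v∈ Uu Uv u~v eq with u ≟ w | v ≟ w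
      ... | yes refl | yes refl = adj-irrefl G refl u~v
      ... | yes refl | no v≢w   = unused u~v Uv
        (trans (sym (updateAt-minimal v w col v≢w)) (trans (sym eq) (updateAt-updates w col)))
      ... | no u≢w   | yes refl = unused (adj-sym G u~v) Uu
        (trans (sym (updateAt-minimal u w col u≢w)) (trans eq (updateAt-updates w col)))
      ... | no u≢w   | no v≢w   = proper (∈-tail u≢w u∈) (∈-tail v≢w v∈) Uu Uv u~v
        (trans (sym (updateAt-minimal u w col u≢w)) (trans eq (updateAt-minimal v w col v≢w)))

    -- Class `c` is played first: it is independent, and each of its vertices has at most `d`
    -- neighbours in the lower classes.
    partite-losing : ∀ {r s} (col : V → Fin r) →
                     (∀ {u v} → U u → U v → u ~ v → col u ≢ col v) →
                     ∀ c → Losing s (partiteBound d c s) (λ v → U v × toℕ (col v) < c)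
    partite-losing col proper zero    = independent-losing λ ()
    partite-losing col proper (suc c) =
      union-losing {A = λ v → U v × toℕ (col v) ≡ c}
        (λ v → U? v ×-dec (toℕ (col v) <? c))
        (λ { (Uv , refl) → Uv , ≤-refl })
        (λ (Uv , <c) → Uv , m≤n⇒m≤1+n <c)
        (λ (Uv , <1+c) → split Uv (m<1+n⇒m<n∨m≡n <1+c))
        us
        (λ (Uv , _) → us≤d Uv)
        (λ (Uv , _) (Uu , _) → ∈us Uv Uu)
        (independent-losing λ (Uu , eu) (Uv , ev) u~v →
          proper Uu Uv u~v (toℕ-injective (trans eu (sym ev))))
        (partite-losing col proper c)
      where
      split : ∀ {v} → U v → toℕ (col v) < c ⊎ toℕ (col v) ≡ c →
              (U v × toℕ (col v) ≡ c) ⊎ (U v × toℕ (col v) < c)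
      split Uv (inj₁ <c) = inj₂ (Uv , <c)
      split Uv (inj₂ ≡c) = inj₁ (Uv , ≡c)

    boundedDegree-losing : ∀ {s} → Losing s (partiteBound d (suc d) s) U
    boundedDegree-losing = let (col , proper) = colouring (allFin (order G)) in
      losing-resp proj₁ (λ Uv → Uv , toℕ<n _)
        (partite-losing col (proper (∈-allFin _) (∈-allFin _)) (suc d))

  module _ {U : Pred V 0ℓ} (U? : Decidable U) where

    neighboursIn : V → List V
    neighboursIn v = filter (λ u → adj? G v u ×-dec U? u) (allFin (order G))

    ∈-neighboursIn⁺ : ∀ {v u} → U u → v ~ u → u ∈ neighboursIn v
    ∈-neighboursIn⁺ {v} Uu v~u =
      ∈-filter⁺ (λ u → adj? G v u ×-dec U? u) (∈-allFin _) (v~u , Uu)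

    ∈-neighboursIn⁻ : ∀ {v u} → u ∈ neighboursIn v → v ~ u × U u
    ∈-neighboursIn⁻ {v} u∈ =
      proj₂ (∈-filter⁻ (λ u → adj? G v u ×-dec U? u) {xs = allFin (order G)} u∈)

    neighboursIn-unique : ∀ v → Unique (neighboursIn v)
    neighboursIn-unique v = filter⁺ (λ u → adj? G v u ×-dec U? u) (allFin⁺ (order G))

-- Growing a tree leaf by leaf

module Growth (T : Graph) where

  private
    V = Vertex T
    _~_ = Adj T

  open DecMembership (_≟_ {order T}) using (_∈?_)

  -- xs lists the vertices of a subtree of T such that, read backwards, each
  -- vertex is attached as a leaf to the induced subgraph on its predecessors.
  data Grown : List V → Set where
    root : ∀ r → Grown [ r ]
    leaf : ∀ {xs w a} → Grown xs → w ∉ xs → a ∈ xs → w ~ a →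
           (∀ {b} → b ∈ xs → w ~ b → b ≡ a) → Grown (w ∷ xs)

  -- The vertex list is an index, ready to serve as the vertices of a `Cycle` once it is `Unique`.
  data Trail : V → V → List V → Set where
    stop : ∀ {a} → Trail a a [ a ]
    _∷_  : ∀ {a b c ys} → a ~ b → Trail b c ys → Trail a c (a ∷ ys)

  trail-∷ʳ : ∀ {a b c ys} → Trail a b ys → b ~ c → Trail a c (ys ∷ʳ c)
  trail-∷ʳ stop        b~c = b~c ∷ stop
  trail-∷ʳ (a~b ∷ t)   b~c = a~b ∷ trail-∷ʳ t b~c

  trail-head : ∀ {a b ys} → Trail a b ys → ∃ λ zs → ys ≡ a ∷ zs
  trail-head stop    = _ , refl
  trail-head (_ ∷ _) = _ , refl

  trail-step : ∀ {a b y ys} → Trail a b (y ∷ ys) → ∀ (i : Fin (length ys)) →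
               lookup (y ∷ ys) (inject₁ i) ~ lookup ys i
  trail-step (a~b ∷ stop)    zero    = a~b
  trail-step (a~b ∷ (_ ∷ _)) zero    = a~b
  trail-step (_ ∷ t@(_ ∷ _)) (suc i) = trail-step t i

  trail-last : ∀ {a b y ys} → Trail a b (y ∷ ys) → lookup (y ∷ ys) (fromℕ (length ys)) ≡ b
  trail-last stop              = refl
  trail-last (_ ∷ stop)        = refl
  trail-last (_ ∷ t@(_ ∷ _))   = trail-last t

  -- A leaf is reached through its attachment vertex; the rest of the path stays in the older list,
  -- so the leaf is not repeated.
  grown-connected : ∀ {xs} → Grown xs → ∀ {a b} → a ∈ xs → b ∈ xs →
                    ∃ λ ys → Trail a b ys × Unique ys × ys ⊆ xs
  grown-connected (root r) (here refl) (here refl) = [ r ] , stop , All.[] ∷ [] , id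
  grown-connected (leaf g w∉ a∈ w~a _) (here refl) (here refl) =
    [ _ ] , stop , All.[] ∷ [] , λ { (here eq) → here eq }
  grown-connected (leaf g w∉ a∈ w~a _) (here refl) (there b∈) =
    let (ys , t , uniq , ys⊆) = grown-connected g a∈ b∈ in
    _ ∷ ys , w~a ∷ t , ¬Any⇒All¬ ys (w∉ ∘ ys⊆) ∷ uniq ,
    λ { (here eq) → here eq ; (there y∈) → there (ys⊆ y∈) }
  grown-connected {w ∷ xs} (leaf g w∉ a∈ w~a _) (there b∈) (here refl) =
    let (ys , t , uniq , ys⊆) = grown-connected g b∈ a∈ in
    ys ∷ʳ w , trail-∷ʳ t (adj-sym T w~a) ,
    ++⁺ uniq (All.[] ∷ []) (λ { (y∈ , here refl) → w∉ (ys⊆ y∈) }) ,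
    snoc-⊆ ys⊆
    where
    snoc-⊆ : ∀ {ys} → ys ⊆ xs → ys ∷ʳ w ⊆ w ∷ xs
    snoc-⊆ {ys} ys⊆ y∈ with ∈-++⁻ ys y∈
    ... | inj₁ y∈ys      = there (ys⊆ y∈ys)
    ... | inj₂ (here eq) = here eq
  grown-connected (leaf g _ _ _ _) (there a∈) (there b∈) =
    let (ys , t , uniq , ys⊆) = grown-connected g a∈ b∈ in ys , t , uniq , there ∘ ys⊆

  -- Since `a ≢ b`, the trail has at least two vertices, giving with `w` the three that a `Cycle`
  -- requires; `trail-head` exposes the second one.
  trail⇒cycle : ∀ {a b w ys} → a ≢ b → Trail a b ys → Unique ys → w ∉ ys →
                w ~ a → b ~ w → Cycle T
  trail⇒cycle a≢b stop _ _ _ _ = contradiction refl a≢b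
  trail⇒cycle {w = w} _ t@(_ ∷ t′) uniq w∉ w~a b~w with trail-head t′
  ... | ys , refl = record
    { k         = length ys
    ; vertex    = lookup (w ∷ _ ∷ _ ∷ ys)
    ; injective = lookup-injective (¬Any⇒All¬ _ w∉ ∷ uniq)
    ; step      = trail-step (w~a ∷ t)
    ; close     = subst (_~ w) (sym (trail-last (w~a ∷ t))) b~w
    }

  module _ (acyclic : ¬ Cycle T) where

    -- A second neighbour would close a cycle through `w` and a path from `a` to `b` in the grown
    -- part.
    uniqueNeighbour : ∀ {xs w a b} → Grown xs → w ∉ xs → a ∈ xs → w ~ a →
                      b ∈ xs → w ~ b → b ≡ a
    uniqueNeighbour {a = a} {b} g w∉ a∈ w~a b∈ w~b with a ≟ b
    ... | yes a≡b = sym a≡b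
    ... | no  a≢b = let (ys , t , uniq , ys⊆) = grown-connected g a∈ b∈ in
      contradiction (trail⇒cycle a≢b t uniq (w∉ ∘ ys⊆) w~a (adj-sym T w~b)) acyclic

    -- Each vertex of the walk not yet listed becomes a leaf at its predecessor on the walk.
    growAlong : ∀ {xs x y} → Grown xs → x ∈ xs → Star _~_ x y →
                ∃ λ xs′ → Grown xs′ × xs ⊆ xs′ × y ∈ xs′
    growAlong g x∈ ε = _ , g , id , x∈
    growAlong {xs} g x∈ (_◅_ {j = z} x~z walk) with z ∈? xs
    ... | yes z∈ = growAlong g z∈ walk
    ... | no  z∉ =
      let z~x = adj-sym T x~z
          g′  = leaf g z∉ x∈ z~x (uniqueNeighbour g z∉ x∈ z~x)
          (xs′ , g″ , ⊆xs′ , y∈) = growAlong g′ (here refl) walk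
      in xs′ , g″ , ⊆xs′ ∘ there , y∈

    growOver : ∀ r → (∀ v → Star _~_ r v) → ∀ ys →
               ∃ λ xs → Grown xs × r ∈ xs × ys ⊆ xs
    growOver r conn []       = [ r ] , root r , here refl , λ ()
    growOver r conn (y ∷ ys) =
      let (xs , g , r∈ , ys⊆) = growOver r conn ys
          (xs′ , g′ , xs⊆ , y∈) = growAlong g r∈ (conn y)
      in xs′ , g′ , xs⊆ r∈ , λ { (here refl) → y∈ ; (there u∈) → xs⊆ (ys⊆ u∈) }

  tree-grown : IsTree T → ∃ λ xs → Grown xs × (∀ v → v ∈ xs)
  tree-grown isTree =
    let (xs , g , _ , all⊆) = growOver acyclic r (connected r) (allFin (order T))
    in xs , g , λ v → all⊆ (∈-allFin v)
    where
    open IsTree isTree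
    inhabitant : ∀ {n} → NonZero n → Fin n
    inhabitant {suc _} _ = zero
    r = inhabitant nonEmpty

  -- Copies of the grown tree in a graph

  -- `embed` is total but constrained only on `xs`, so attaching a leaf is an update at a single
  -- vertex.
  record Embedding (xs : List V) (G : Graph) (U : Pred (Vertex G) 0ℓ) : Set where
    field
      embed     : V → Vertex G
      inside    : ∀ {u} → u ∈ xs → U (embed u)
      injective : ∀ {u v} → u ∈ xs → v ∈ xs → embed u ≡ embed v → u ≡ v
      preserves : ∀ {u v} → u ∈ xs → v ∈ xs → u ~ v → Adj G (embed u) (embed v)

  module _ {G : Graph} {U : Pred (Vertex G) 0ℓ} (U? : Decidable U) where

    open Game G

    -- The image of `a` has more neighbours in `U` than `xs` has entries, so one of them lies off
    -- the image of `xs` and can receive `w`; the edge to `a` is the only new one.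
    attachLeaf : ∀ {xs w a} → w ∉ xs → a ∈ xs → (∀ {b} → b ∈ xs → w ~ b → b ≡ a) →
                 Embedding xs G (λ v → U v × length xs < length (neighboursIn U? v)) →
                 Embedding (w ∷ xs) G U
    attachLeaf {xs} {w} {a} w∉ a∈ only-a e = record
      { embed     = f′
      ; inside    = λ where
          (here refl) → subst U (sym f′w) (proj₂ x-nbr)
          (there u∈)  → subst U (sym (f′≡f u∈)) (proj₁ (inside u∈))
      ; injective = λ where
          (here refl) (here refl) _  → refl
          (here refl) (there v∈)  eq → contradiction (sym eq) (f′≢f′w v∈)
          (there u∈)  (here refl) eq → contradiction eq (f′≢f′w u∈)
          (there u∈)  (there v∈)  eq → injective u∈ v∈ (trans (sym (f′≡f u∈)) (trans eq (f′≡f v∈)))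
      ; preserves = λ where
          (here refl) (here refl) w~w → contradiction w~w (adj-irrefl T refl)
          (here refl) (there v∈)  w~v → adj-sym G (to-x v∈ w~v)
          (there u∈)  (here refl) u~w → to-x u∈ (adj-sym T u~w)
          (there u∈)  (there v∈)  u~v →
            subst₂ (Adj G) (sym (f′≡f u∈)) (sym (f′≡f v∈)) (preserves u∈ v∈ u~v)
      }
      where
      open Embedding e renaming (embed to f)

      nbrs = neighboursIn U? (f a)
      new = fresh _≟_ (proj₂ (inside a∈)) (f ∘ lookup xs)
              (lookup-injective (neighboursIn-unique U? (f a)))
      x = lookup nbrs (proj₁ new)

      x-nbr : Adj G (f a) x × U x
      x-nbr = ∈-neighboursIn⁻ U? (∈-lookup {xs = nbrs} (proj₁ new))

      f≢x : ∀ {u} → u ∈ xs → f u ≢ x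
      f≢x u∈ eq = proj₂ new (index u∈) (trans (cong f (sym (lookup-index u∈))) eq)

      f′ : V → Vertex G
      f′ = updateAt f w (const x)

      f′w : f′ w ≡ x
      f′w = updateAt-updates w f

      f′≡f : ∀ {u} → u ∈ xs → f′ u ≡ f u
      f′≡f {u} u∈ = updateAt-minimal u w f λ { refl → w∉ u∈ }

      f′≢f′w : ∀ {u} → u ∈ xs → f′ u ≢ f′ w
      f′≢f′w u∈ eq = f≢x u∈ (trans (sym (f′≡f u∈)) (trans eq f′w))

      to-x : ∀ {v} → v ∈ xs → w ~ v → Adj G (f′ v) (f′ w)
      to-x v∈ w~v rewrite only-a v∈ w~v =
        subst₂ (Adj G) (sym (f′≡f a∈)) (sym f′w) (proj₁ x-nbr)

  embeddingFree-losing : ∀ {xs} → Grown xs → ∀ s → ∃ λ ℓ → ∀ G {U} → Decidable U →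
                         ¬ Embedding xs G U → Game.Losing G s ℓ U
  -- One vertex embeds in any inhabited `U`, so `U` is empty here.
  embeddingFree-losing (root r) s = s , λ G U? ∄e →
    Game.independent-losing G λ {u} Uu _ _ → ∄e record
      { embed     = const u
      ; inside    = λ _ → Uu
      ; injective = λ { (here refl) (here refl) _ → refl }
      ; preserves = λ { (here refl) (here refl) r~r → contradiction r~r (adj-irrefl T refl) }
      }
  embeddingFree-losing (leaf {xs} g w∉ a∈ w~a only-a) s =
    let (ℓ , lose) = embeddingFree-losing g s
        -- The threshold that `attachLeaf` needs, with neighbours counted inside `U`: the high
        -- vertices carry no copy of the smaller tree.
        d          = length xs
    in partiteBound d (suc d) (suc ℓ ^ d * s) ⊔ ℓ , λ G {U} U? ∄e →
      let open Game G
          us    = neighboursIn U?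
          high? = λ v → U? v ×-dec (d <? length (us v))
          low?  = λ v → U? v ×-dec (length (us v) ≤? d)
      in union-losing high? proj₁ proj₁ (λ {v} Uv → lowOrHigh Uv (length (us v) ≤? d))
           us proj₂ (λ _ (Uu , _) → ∈-neighboursIn⁺ U? Uu)
           (boundedDegree-losing low? us proj₂ (λ _ (Uu , _) → ∈-neighboursIn⁺ U? Uu))
           (lose G high? (∄e ∘ attachLeaf U? w∉ a∈ only-a))
    where
    lowOrHigh : ∀ {P : Set} {m n} → P → Dec (m ≤ n) → (P × m ≤ n) ⊎ (P × n < m)
    lowOrHigh p (yes m≤n) = inj₁ (p , m≤n)
    lowOrHigh p (no  m≰n) = inj₂ (p , ≰⇒> m≰n)

-- Bounding the hat guessing number

-- A winning strategy with more than `ℓ` colours would lose when only `suc ℓ` of them are put on the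
-- hats.
losing⇒HG≤ : ∀ {G ℓ} → Game.Losing G 1 ℓ (λ _ → ⊤) → HG G ≤ ℓ
losing⇒HG≤ {G} {ℓ} lose with HG G ≤? ℓ
... | yes HG≤ℓ = HG≤ℓ
... | no  HG≰ℓ = contradiction (proj₂ (win (ι ∘ φ))) (wrong tt zero)
  where
  ℓ<HG = ≰⇒> HG≰ℓ

  ι : Fin (suc ℓ) → Fin (HG G)
  ι i = inject≤ i ℓ<HG

  -- `HG` is 0 by default when the players never win; `ℓ < HG G` excludes that.
  winning = HG-winning G λ HG≡0 → n≮0 (subst (ℓ <_) HG≡0 ℓ<HG)
  Γ = proj₁ winning
  win = proj₂ winning

  map-cong : ∀ {φ ψ : Vertex G → Fin (suc ℓ)} us → (∀ {u} → u ∈ us → φ u ≡ ψ u) →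
             Vec.map (ι ∘ φ) (fromList us) ≡ Vec.map (ι ∘ ψ) (fromList us)
  map-cong []       e = refl
  map-cong (u ∷ us) e = cong₂ _∷_ (cong ι (e (here refl))) (map-cong us (e ∘ there))

  lost = lose {ι = ι} (inject≤-injective ℓ<HG ℓ<HG _ _)
    (λ v φ _ → Γ v (restrict G (ι ∘ φ) v)) λ {v} _ e _ →
      cong (Γ v) (map-cong (neighbours G v) λ u∈ →
        e tt (proj₂ (∈-filter⁻ (adj? G v) {xs = allFin (order G)} u∈)))
  φ = proj₁ lost
  wrong = proj₂ lost

theorem1p1 : (T : Graph) → IsTree T → ∃[ N ] ((G : Graph) → ¬ (T ⊑ G) → HG G ≤ N)
theorem1p1 T isTree =
  let (xs , grown , ∈xs) = tree-grown isTree
      (N , lose)         = embeddingFree-losing grown 1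
  -- As `xs` lists every vertex of `T`, an embedding of `xs` is a copy of `T`.
  in N , λ G T⋢G → losing⇒HG≤ {G} (lose G (λ _ → yes tt) λ e →
    let open Embedding e in T⋢G record
      { embed     = embed
      ; injective = injective (∈xs _) (∈xs _)
      ; preserves = preserves (∈xs _) (∈xs _)
      })
  where open Growth T
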